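{- Let $H$ be a Hadamard matrix of order $n$ and let $m$ be an integer with $n \ge m > 1$. Then the mean value $E(\det(M)^2)$ of $\det(M)^2$, taken over all $m\times m$ submatrices $M$ of $H$, satisfies $$E(\det(M)^2) > m!.$$
   Context: A Hadamard matrix of order $n$ is an $n\times n$ matrix $H$ with entries in $\{+1,-1\}$ satisfying $HH^T = nI$. An $m\times m$ submatrix of $H$ is obtained by choosing $m$ of the rows and $m$ of the columns (not necessarily consecutive). Submatrices are indexed by the choice of rows and columns, so there are exactly $\binom{n}{m}^2$ of them, and the mean is the uniform average over these choices. -}

module Defs where

open import Data.Bool.Base using (if_then_else_)
open import Data.Empty using (⊥)
open import Data.Fin.Base as Fin using (Fin; zero; suc; toℕ; punchIn)
import Data.Fin.Properties as Fin
open import Data.Integer.Base using (ℤ; +_; 0ℤ; 1ℤ; -1ℤ; _+_; _*_; _^_)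
open import Data.Integer.Properties using (+-*-semiring)
open import Data.List.Base as List using (List; []; _∷_; _++_; cartesianProduct; foldr; length)
open import Data.List.Membership.Propositional using (_∈_)
open import Data.List.Membership.Propositional.Properties using (∈-map⁺; ∈-map⁻; ∈-++⁺ˡ; ∈-++⁺ʳ)
import Data.List.Properties as List
import Data.List.Relation.Unary.All as ListAll
import Data.List.Relation.Unary.All.Properties as ListAll
open import Data.List.Relation.Unary.Any using (here)
open import Data.List.Relation.Unary.AllPairs as ListAllPairs using ()
open import Data.List.Relation.Unary.Unique.Propositional using (Unique)
import Data.List.Relation.Unary.Unique.Propositional.Properties as Unique
open import Data.Nat.Base as ℕ using (ℕ; zero; suc; _≤_; z≤n; s≤s; NonZero)
open import Data.Nat.Combinatorics using (_C_; nCk+nC[k+1]≡[n+1]C[k+1])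
import Data.Nat.Properties as ℕ
open import Data.Product.Base using (_×_; _,_; uncurry; ∃-syntax)
open import Data.Rational.Base using (ℚ; _/_)
open import Data.Sum.Base using (_⊎_)
open import Data.Vec.Base as Vec using (Vec; []; _∷_; lookup)
import Data.Vec.Properties as Vec
open import Data.Vec.Relation.Unary.All as All using (All; []; _∷_)
import Data.Vec.Relation.Unary.All.Properties as All
open import Data.Vec.Relation.Unary.AllPairs as AllPairs using (AllPairs; []; _∷_)
import Data.Vec.Relation.Unary.AllPairs.Properties as AllPairs
open import Function.Base using (_∘_)
open import Relation.Binary.PropositionalEquality
  using (_≡_; refl; sym; trans; cong₂)
open import Relation.Nullary.Decidable.Core using (does)

------------------------------------------------------------------------
-- Integer matrices

open import Algebra.Properties.Semiring.Sum +-*-semiring public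
  using (sum)

Matrix : ℕ → ℕ → Set
Matrix m n = Fin m → Fin n → ℤ

infixl 7 _⊗_
infix 8 _ᵀ

_⊗_ : ∀ {m n p} → Matrix m n → Matrix n p → Matrix m p
(A ⊗ B) i k = sum λ j → A i j * B j k

_ᵀ : ∀ {m n} → Matrix m n → Matrix n m
(A ᵀ) i j = A j i

𝟙 : ∀ {n} → Matrix n n
𝟙 i j = if does (i Fin.≟ j) then 1ℤ else 0ℤ

-- Cofactor expansion along the first row.
det : ∀ {n} → Matrix n n → ℤ
det {zero}  A = 1ℤ
det {suc n} A =
  sum λ j → -1ℤ ^ toℕ j * A zero j * det (λ i k → A (suc i) (punchIn j k))

record IsHadamard {n : ℕ} (H : Matrix n n) : Set where
  field
    entries    : ∀ i j → H i j ≡ 1ℤ ⊎ H i j ≡ -1ℤ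
    orthogonal : ∀ i k → (H ⊗ H ᵀ) i k ≡ + n * 𝟙 i k

------------------------------------------------------------------------
-- Choices of m out of n indices

-- An m-element subset of Fin n is represented by the strictly increasing
-- vector of its elements; `choices n m` lists each of them exactly once
-- (see `choices-increasing`, `choices-complete` and `choices-unique`).
choices : ∀ n m → List (Vec (Fin n) m)
choices n       zero    = [] ∷ []
choices zero    (suc m) = []
choices (suc n) (suc m) =
  List.map (λ s → zero ∷ Vec.map suc s) (choices n m) ++
  List.map (Vec.map suc) (choices n (suc m))

Increasing : ∀ {n m} → Vec (Fin n) m → Set
Increasing = AllPairs Fin._<_

private
  map-suc-increasing : ∀ {n m} {s : Vec (Fin n) m} →
                       Increasing s → Increasing (Vec.map suc s)
  map-suc-increasing = AllPairs.map⁺ ∘ AllPairs.map s≤s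

  zero<map-suc : ∀ {n m} (s : Vec (Fin n) m) →
                 All (zero {suc n} Fin.<_) (Vec.map suc s)
  zero<map-suc s = All.map⁺ (All.universal (λ _ → s≤s z≤n) s)

  map-suc-injective : ∀ {n m} {s t : Vec (Fin n) m} →
                      Vec.map Fin.suc s ≡ Vec.map Fin.suc t → s ≡ t
  map-suc-injective {s = []}    {[]}    _  = refl
  map-suc-injective {s = x ∷ s} {y ∷ t} eq = cong₂ _∷_
    (Fin.suc-injective (Vec.∷-injectiveˡ eq))
    (map-suc-injective (Vec.∷-injectiveʳ eq))

  -- Vectors avoiding zero are images under suc.
  unmap-suc : ∀ {n m} {i : Fin (suc n)} {s : Vec (Fin (suc n)) m} →
              All (i Fin.<_) s → ∃[ t ] s ≡ Vec.map suc t
  unmap-suc []                                    = [] , refl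
  unmap-suc (_∷_ {x = suc x} _ i<s) with unmap-suc i<s
  ... | t , refl = x ∷ t , refl

  map-suc-increasing⁻ : ∀ {n m} (s : Vec (Fin n) m) →
                        Increasing (Vec.map suc s) → Increasing s
  map-suc-increasing⁻ []      _            = []
  map-suc-increasing⁻ (x ∷ s) (x<s ∷ inc) =
    All.map ℕ.s≤s⁻¹ (All.map⁻ x<s) ∷ map-suc-increasing⁻ s inc

choices-increasing : ∀ n m → ListAll.All Increasing (choices n m)
choices-increasing n       zero    = [] ListAll.∷ ListAll.[]
choices-increasing zero    (suc m) = ListAll.[]
choices-increasing (suc n) (suc m) = ListAll.++⁺
  (ListAll.map⁺ (ListAll.map
    (λ {s} inc → zero<map-suc s ∷ map-suc-increasing inc)
    (choices-increasing n m)))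
  (ListAll.map⁺ (ListAll.map map-suc-increasing
    (choices-increasing n (suc m))))

choices-complete : ∀ {n m} {s : Vec (Fin n) m} → Increasing s → s ∈ choices n m
choices-complete {n} {s = []} _ = here refl
choices-complete {suc n} {s = zero ∷ s} (0<s ∷ inc) with unmap-suc 0<s
... | t , refl = ∈-++⁺ˡ
  (∈-map⁺ (λ s → zero ∷ Vec.map suc s) (choices-complete (map-suc-increasing⁻ t inc)))
choices-complete {suc n} {s = suc x ∷ s} (x<s ∷ inc) with unmap-suc x<s
... | t , refl = ∈-++⁺ʳ (List.map (λ s → zero ∷ Vec.map suc s) (choices n _))
  (∈-map⁺ (Vec.map suc) (choices-complete (map-suc-increasing⁻ (x ∷ t) (x<s ∷ inc))))

choices-unique : ∀ n m → Unique (choices n m)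
choices-unique n       zero    = ListAll.[] ListAllPairs.∷ ListAllPairs.[]
choices-unique zero    (suc m) = ListAllPairs.[]
choices-unique (suc n) (suc m) = Unique.++⁺
  (Unique.map⁺ (map-suc-injective ∘ Vec.∷-injectiveʳ) (choices-unique n m))
  (Unique.map⁺ map-suc-injective (choices-unique n (suc m)))
  λ (p , q) → disjoint (∈-map⁻ _ p) (∈-map⁻ _ q)
  where
  disjoint : ∀ {v : Vec (Fin (suc n)) (suc m)} →
             ∃[ s ] (s ∈ choices n m × v ≡ zero ∷ Vec.map suc s) →
             ∃[ t ] (t ∈ choices n (suc m) × v ≡ Vec.map suc t) → ⊥
  disjoint (_ , _ , refl) (_ ∷ _ , _ , ())

length-choices : ∀ n m → length (choices n m) ≡ n C m
length-choices n       zero    = refl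
length-choices zero    (suc m) = refl
length-choices (suc n) (suc m) = trans
  (List.length-++ (List.map _ (choices n m)))
  (trans
    (cong₂ ℕ._+_
      (trans (List.length-map _ (choices n m)) (length-choices n m))
      (trans (List.length-map _ (choices n (suc m))) (length-choices n (suc m))))
    (nCk+nC[k+1]≡[n+1]C[k+1] n m))

------------------------------------------------------------------------
-- Submatrices and means

submatrix : ∀ {n m} → Matrix n n → Vec (Fin n) m → Vec (Fin n) m → Matrix m m
submatrix H r c i j = H (lookup r i) (lookup c j)

-- Indexed by the choices of rows and columns, so equal submatrices in
-- different positions are counted separately.
submatrices : ∀ {n} m → Matrix n n → List (Matrix m m)
submatrices {n} m H =
  List.map (uncurry (submatrix H)) (cartesianProduct (choices n m) (choices n m))

private
  length-cartesianProduct : ∀ {a b} {A : Set a} {B : Set b} (xs : List A) (ys : List B) →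
                            length (cartesianProduct xs ys) ≡ length xs ℕ.* length ys
  length-cartesianProduct []       ys = refl
  length-cartesianProduct (x ∷ xs) ys = trans
    (List.length-++ (List.map (x ,_) ys))
    (cong₂ ℕ._+_ (List.length-map (x ,_) ys) (length-cartesianProduct xs ys))

length-submatrices : ∀ {n} m (H : Matrix n n) →
                     length (submatrices m H) ≡ (n C m) ℕ.^ 2
length-submatrices {n} m H = trans
  (List.length-map _ (cartesianProduct (choices n m) (choices n m)))
  (trans (length-cartesianProduct (choices n m) (choices n m))
    (cong₂ ℕ._*_ (length-choices n m)
      (trans (length-choices n m) (sym (ℕ.*-identityʳ (n C m))))))

private
  choices-nonZero : ∀ {n m} → m ≤ n → NonZero (length (choices n m))
  choices-nonZero z≤n = _
  choices-nonZero {suc n} {suc m} (s≤s m≤n)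
    with choices n m | choices-nonZero m≤n
  ... | _ ∷ _ | _ = _

submatrices-nonZero : ∀ {n m} (H : Matrix n n) → m ≤ n →
                      NonZero (length (submatrices m H))
submatrices-nonZero {n} {m} H m≤n
  with choices n m | choices-nonZero m≤n
... | _ ∷ _ | _ = _

mean : ∀ {a} {A : Set a} (f : A → ℤ) (xs : List A) →
       .{{NonZero (length xs)}} → ℚ
mean f xs = foldr _+_ 0ℤ (List.map f xs) / length xs

{-# OPTIONS --safe #-}

-- The m × m minors of an m × n matrix with rows
-- b₁, …, bₘ are the coordinates of b₁ ∧ … ∧ bₘ, so their squares add up to its
-- squared norm.  Contraction with a is adjoint to a ∧_ and anticommutes with b ∧_
-- up to the scalar a · b, hence for orthogonal rows of squared length n this norm
-- is nᵐ.  So the mean in question is nᵐ / (n C m), and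
-- m! (n C m) = n (n − 1) ⋯ (n − m + 1) < nᵐ for m > 1.
module Submission where

open import Defs
open import Data.Empty using (⊥-elim)
open import Data.Fin.Base using (Fin; zero; suc; toℕ; punchIn)
import Data.Fin.Properties as Fin
open import Data.Fin.Subset using (Subset; inside; outside)
open import Data.Integer.Base as ℤ using (ℤ; +_; 0ℤ; 1ℤ; -1ℤ; _+_; _*_; _^_; +<+)
import Data.Integer.Properties as ℤ
open import Data.Integer.Tactic.RingSolver using (solve-∀)
open import Data.List.Base as List
  using (List; []; _∷_; _++_; cartesianProduct; foldr; length; tabulate)
import Data.List.Properties as List
open import Data.List.Relation.Unary.All as ListAll using ([]; _∷_)
open import Data.Nat.Base as ℕ using (ℕ; zero; suc; _≤_; _<_; _!; z≤n; s≤s; NonZero)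
open import Data.Nat.Combinatorics using (_C_; nC1≡n; nCk+nC[k+1]≡[n+1]C[k+1])
import Data.Nat.Properties as ℕ
import Data.Nat.Tactic.RingSolver as ℕSolver
open import Data.Product.Base using (_×_; _,_; uncurry)
open import Data.Rational.Base using (_/_; _>_)
import Data.Rational.Properties as ℚ
open import Data.Rational.Unnormalised.Base using (mkℚᵘ; *<*)
import Data.Rational.Unnormalised.Properties as ℚᵘ
open import Data.Vec.Base as Vec using (Vec; []; _∷_; lookup; toList)
import Data.Vec.Properties as Vec
import Data.Vec.Relation.Unary.AllPairs as AllPairs
open import Data.Vec.Relation.Unary.Unique.Propositional.Properties using (lookup-injective)
open import Function.Base using (_∘_)
open import Relation.Binary.PropositionalEquality
  using (_≡_; _≢_; _≗_; refl; sym; trans; cong; cong₂; subst; module ≡-Reasoning)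
open import Relation.Nullary.Decidable.Core using (yes; no)

open import Algebra.Properties.Semiring.Sum ℤ.+-*-semiring
  using (*-distribˡ-sum; sum-cong-≗)

open ≡-Reasoning

private
  variable
    A B : Set
    m n : ℕ

-- The exterior algebra of ℤⁿ

-- f s is the coefficient of f at the wedge of the basis vectors in s, taken in
-- increasing order.
Form : ℕ → Set
Form n = Subset n → ℤ

infixr 8 _∧_ _⌟_
infix 8 _·_

_·_ : (Fin n → ℤ) → (Fin n → ℤ) → ℤ
a · b = sum λ j → a j * b j

-- With `e` the first basis vector, `f` splits as `e ∧ f₁ + f₀`, where `f₁` and `f₀` are read off at
-- `inside` and `outside`. The sign arises when the tail of `b` moves past `e`.
_∧_ : (Fin n → ℤ) → Form n → Form n
(b ∧ f) []            = 0ℤ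
(b ∧ f) (inside  ∷ s) =
  b zero * f (outside ∷ s) + -1ℤ * ((b ∘ suc) ∧ (f ∘ (inside ∷_))) s
(b ∧ f) (outside ∷ s) = ((b ∘ suc) ∧ (f ∘ (outside ∷_))) s

-- The antiderivation of the exterior algebra that sends a vector `v` to `a · v`, for the same
-- splitting of `f`. The sign again comes from passing the first basis vector.
_⌟_ : (Fin n → ℤ) → Form n → Form n
(a ⌟ f) []            = 0ℤ
(a ⌟ f) (inside  ∷ s) = -1ℤ * ((a ∘ suc) ⌟ (f ∘ (inside ∷_))) s
(a ⌟ f) (outside ∷ s) =
  a zero * f (inside ∷ s) + ((a ∘ suc) ⌟ (f ∘ (outside ∷_))) s

-- The pointwise hypothesis avoids function extensionality. Suitable choices of `p` and `q` turn
-- this one form into additivity, scaling, congruence and preservation of zero.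
∧-linear : ∀ (b : Fin n → ℤ) {f : Form n} p g q h →
           (∀ s → f s ≡ p * g s + q * h s) →
           ∀ s → (b ∧ f) s ≡ p * (b ∧ g) s + q * (b ∧ h) s
∧-linear b p g q h eq []            = zeros p q
  where
  zeros : ∀ p q → 0ℤ ≡ p * 0ℤ + q * 0ℤ
  zeros = solve-∀
∧-linear b p g q h eq (inside  ∷ s) = trans
  (cong₂ (λ x y → b zero * x + -1ℤ * y) (eq (outside ∷ s))
    (∧-linear (b ∘ suc) p _ q _ (eq ∘ (inside ∷_)) s))
  (rearrange (b zero) p q _ _ _ _)
  where
  rearrange : ∀ b p q x y z w → b * (p * x + q * y) + -1ℤ * (p * z + q * w) ≡
                                p * (b * x + -1ℤ * z) + q * (b * y + -1ℤ * w)
  rearrange = solve-∀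
∧-linear b p g q h eq (outside ∷ s) =
  ∧-linear (b ∘ suc) p _ q _ (eq ∘ (outside ∷_)) s

⌟-linear : ∀ (a : Fin n → ℤ) {f : Form n} p g q h →
           (∀ s → f s ≡ p * g s + q * h s) →
           ∀ s → (a ⌟ f) s ≡ p * (a ⌟ g) s + q * (a ⌟ h) s
⌟-linear a p g q h eq []            = zeros p q
  where
  zeros : ∀ p q → 0ℤ ≡ p * 0ℤ + q * 0ℤ
  zeros = solve-∀
⌟-linear a p g q h eq (inside  ∷ s) = trans
  (cong (-1ℤ *_) (⌟-linear (a ∘ suc) p _ q _ (eq ∘ (inside ∷_)) s))
  (rearrange p q _ _)
  where
  rearrange : ∀ p q x y → -1ℤ * (p * x + q * y) ≡ p * (-1ℤ * x) + q * (-1ℤ * y)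
  rearrange = solve-∀
⌟-linear a p g q h eq (outside ∷ s) = trans
  (cong₂ (λ x y → a zero * x + y) (eq (inside ∷ s))
    (⌟-linear (a ∘ suc) p _ q _ (eq ∘ (outside ∷_)) s))
  (rearrange (a zero) p q _ _ _ _)
  where
  rearrange : ∀ a p q x y z w → a * (p * x + q * y) + (p * z + q * w) ≡
                                p * (a * x + z) + q * (a * y + w)
  rearrange = solve-∀

∧-cong : ∀ (b : Fin n → ℤ) {f g : Form n} → f ≗ g → b ∧ f ≗ b ∧ g
∧-cong b {g = g} eq s = trans
  (∧-linear b 1ℤ g 0ℤ g (λ s → trans (eq s) (one (g s))) s) (sym (one _))
  where
  one : ∀ x → x ≡ 1ℤ * x + 0ℤ * x
  one = solve-∀

∧-zero : ∀ (b : Fin n → ℤ) {f : Form n} → (∀ s → f s ≡ 0ℤ) → ∀ s → (b ∧ f) s ≡ 0ℤ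
-- `0ℤ * x + 0ℤ * y` computes to `0ℤ`, so linearity with both coefficients zero has exactly the
-- required type.
∧-zero b {f} eq = ∧-linear b 0ℤ f 0ℤ f eq

⌟-zero : ∀ (a : Fin n → ℤ) {f : Form n} → (∀ s → f s ≡ 0ℤ) → ∀ s → (a ⌟ f) s ≡ 0ℤ
⌟-zero a {f} eq = ⌟-linear a 0ℤ f 0ℤ f eq

-- The Clifford relation. Of the terms that involve the first coordinate, the mixed ones cancel by
-- their signs and `a zero * b zero` survives; the rest is the relation for the tails.
⌟-∧-anticommute : ∀ (a b : Fin n → ℤ) f s →
                  (a ⌟ b ∧ f) s + (b ∧ a ⌟ f) s ≡ a · b * f s
⌟-∧-anticommute a b f []            = refl
⌟-∧-anticommute a b f (inside  ∷ s) = begin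
  -1ℤ * (a′ ⌟ (λ t → b zero * f₀ t + -1ℤ * (b′ ∧ f₁) t)) s +
    (b zero * (a zero * f₁ s + (a′ ⌟ f₀) s) +
     -1ℤ * (b′ ∧ (λ t → -1ℤ * (a′ ⌟ f₁) t)) s)
    ≡⟨ cong₂ (λ x y → -1ℤ * x + (b zero * (a zero * f₁ s + (a′ ⌟ f₀) s) + -1ℤ * y))
         (⌟-linear a′ (b zero) f₀ -1ℤ (b′ ∧ f₁) (λ _ → refl) s)
         (∧-linear b′ -1ℤ (a′ ⌟ f₁) 0ℤ (a′ ⌟ f₁) (λ _ → sym (ℤ.+-identityʳ _)) s) ⟩
  -1ℤ * (b zero * (a′ ⌟ f₀) s + -1ℤ * (a′ ⌟ b′ ∧ f₁) s) +
    (b zero * (a zero * f₁ s + (a′ ⌟ f₀) s) +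
     -1ℤ * (-1ℤ * (b′ ∧ a′ ⌟ f₁) s + 0ℤ))
    ≡⟨ cancel (a zero) (b zero) _ _ _ _ ⟩
  a zero * b zero * f₁ s + ((a′ ⌟ b′ ∧ f₁) s + (b′ ∧ a′ ⌟ f₁) s)
    ≡⟨ cong (λ x → a zero * b zero * f₁ s + x) (⌟-∧-anticommute a′ b′ f₁ s) ⟩
  a zero * b zero * f₁ s + a′ · b′ * f₁ s
    ≡⟨ ℤ.*-distribʳ-+ (f₁ s) (a zero * b zero) (a′ · b′) ⟨
  a · b * f₁ s ∎
  where
  a′ = a ∘ suc
  b′ = b ∘ suc
  f₀ = f ∘ (outside ∷_)
  f₁ = f ∘ (inside ∷_)
  cancel : ∀ a b x y z w →
    -1ℤ * (b * y + -1ℤ * z) + (b * (a * x + y) + -1ℤ * (-1ℤ * w + 0ℤ)) ≡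
    a * b * x + (z + w)
  cancel = solve-∀
⌟-∧-anticommute a b f (outside ∷ s) = begin
  (a zero * (b zero * f₀ s + -1ℤ * (b′ ∧ f₁) s) + (a′ ⌟ b′ ∧ f₀) s) +
    (b′ ∧ (λ t → a zero * f₁ t + (a′ ⌟ f₀) t)) s
    ≡⟨ cong (λ x → (a zero * (b zero * f₀ s + -1ℤ * (b′ ∧ f₁) s) + (a′ ⌟ b′ ∧ f₀) s) + x)
         (∧-linear b′ (a zero) f₁ 1ℤ (a′ ⌟ f₀)
           (λ t → cong (λ x → a zero * f₁ t + x) (sym (ℤ.*-identityˡ _))) s) ⟩
  (a zero * (b zero * f₀ s + -1ℤ * (b′ ∧ f₁) s) + (a′ ⌟ b′ ∧ f₀) s) +
    (a zero * (b′ ∧ f₁) s + 1ℤ * (b′ ∧ a′ ⌟ f₀) s)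
    ≡⟨ cancel (a zero) (b zero) _ _ _ _ ⟩
  a zero * b zero * f₀ s + ((a′ ⌟ b′ ∧ f₀) s + (b′ ∧ a′ ⌟ f₀) s)
    ≡⟨ cong (λ x → a zero * b zero * f₀ s + x) (⌟-∧-anticommute a′ b′ f₀ s) ⟩
  a zero * b zero * f₀ s + a′ · b′ * f₀ s
    ≡⟨ ℤ.*-distribʳ-+ (f₀ s) (a zero * b zero) (a′ · b′) ⟨
  a · b * f₀ s ∎
  where
  a′ = a ∘ suc
  b′ = b ∘ suc
  f₀ = f ∘ (outside ∷_)
  f₁ = f ∘ (inside ∷_)
  cancel : ∀ a b x y z w →
    (a * (b * x + -1ℤ * y) + z) + (a * y + 1ℤ * w) ≡ a * b * x + (z + w)
  cancel = solve-∀

-- The inner product of the components of degree m.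
inner : ℕ → Form n → Form n → ℤ
inner {zero}  zero    f g = f [] * g []
inner {zero}  (suc m) f g = 0ℤ
inner {suc n} zero    f g = inner zero (f ∘ (outside ∷_)) (g ∘ (outside ∷_))
inner {suc n} (suc m) f g =
  inner m (f ∘ (inside ∷_)) (g ∘ (inside ∷_)) +
  inner (suc m) (f ∘ (outside ∷_)) (g ∘ (outside ∷_))

inner-comm : ∀ m (f g : Form n) → inner m f g ≡ inner m g f
inner-comm {zero}  zero    f g = ℤ.*-comm (f []) (g [])
inner-comm {zero}  (suc m) f g = refl
inner-comm {suc n} zero    f g = inner-comm zero (f ∘ (outside ∷_)) (g ∘ (outside ∷_))
inner-comm {suc n} (suc m) f g = cong₂ _+_
  (inner-comm m (f ∘ (inside ∷_)) (g ∘ (inside ∷_)))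
  (inner-comm (suc m) (f ∘ (outside ∷_)) (g ∘ (outside ∷_)))

inner-linearʳ : ∀ m (k : Form n) {f : Form n} p g q h →
                (∀ s → f s ≡ p * g s + q * h s) →
                inner m k f ≡ p * inner m k g + q * inner m k h
inner-linearʳ {zero}  zero    k p g q h eq =
  trans (cong (k [] *_) (eq [])) (rearrange (k []) p q _ _)
  where
  rearrange : ∀ k p q x y → k * (p * x + q * y) ≡ p * (k * x) + q * (k * y)
  rearrange = solve-∀
inner-linearʳ {zero}  (suc m) k p g q h eq = zeros p q
  where
  zeros : ∀ p q → 0ℤ ≡ p * 0ℤ + q * 0ℤ
  zeros = solve-∀
inner-linearʳ {suc n} zero    k p g q h eq =
  inner-linearʳ zero _ p _ q _ (eq ∘ (outside ∷_))
inner-linearʳ {suc n} (suc m) k p g q h eq = trans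
  (cong₂ _+_ (inner-linearʳ m _ p _ q _ (eq ∘ (inside ∷_)))
             (inner-linearʳ (suc m) _ p _ q _ (eq ∘ (outside ∷_))))
  (rearrange p q _ _ _ _)
  where
  rearrange : ∀ p q x y z w → (p * x + q * y) + (p * z + q * w) ≡
                              p * (x + z) + q * (y + w)
  rearrange = solve-∀

inner-linearˡ : ∀ m (k : Form n) {f : Form n} p g q h →
                (∀ s → f s ≡ p * g s + q * h s) →
                inner m f k ≡ p * inner m g k + q * inner m h k
inner-linearˡ m k p g q h eq = trans (inner-comm m _ k)
  (trans (inner-linearʳ m k p g q h eq)
    (cong₂ (λ x y → p * x + q * y) (inner-comm m k g) (inner-comm m k h)))

inner-zero-∧ : ∀ (b : Fin n → ℤ) f g → inner zero (b ∧ f) g ≡ 0ℤ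
inner-zero-∧ {zero}  b f g = refl
inner-zero-∧ {suc n} b f g = inner-zero-∧ (b ∘ suc) _ _

-- The degree shifts because a wedge with a vector raises degree by one. Both sides are split at the
-- first index and compared by induction on `n`.
∧-⌟-adjoint : ∀ m (b : Fin n → ℤ) f g → inner (suc m) (b ∧ f) g ≡ inner m f (b ⌟ g)
∧-⌟-adjoint {zero}  zero    b f g = sym (ℤ.*-zeroʳ (f []))
∧-⌟-adjoint {zero}  (suc m) b f g = refl
∧-⌟-adjoint {suc n} m b f g = begin
  inner m (λ s → b zero * f₀ s + -1ℤ * (b′ ∧ f₁) s) g₁ + inner (suc m) (b′ ∧ f₀) g₀
    ≡⟨ cong₂ _+_ (inner-linearˡ m g₁ (b zero) f₀ -1ℤ (b′ ∧ f₁) (λ _ → refl))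
         (∧-⌟-adjoint m b′ f₀ g₀) ⟩
  (b zero * inner m f₀ g₁ + -1ℤ * inner m (b′ ∧ f₁) g₁) + inner m f₀ (b′ ⌟ g₀)
    ≡⟨ step m ⟩
  inner m f (b ⌟ g) ∎
  where
  b′ = b ∘ suc
  f₀ = f ∘ (outside ∷_)
  f₁ = f ∘ (inside ∷_)
  g₀ = g ∘ (outside ∷_)
  g₁ = g ∘ (inside ∷_)
  split : ∀ m → inner m f₀ (λ s → b zero * g₁ s + (b′ ⌟ g₀) s) ≡
                b zero * inner m f₀ g₁ + 1ℤ * inner m f₀ (b′ ⌟ g₀)
  split m = inner-linearʳ m f₀ (b zero) g₁ 1ℤ (b′ ⌟ g₀)
    (λ s → cong (λ x → b zero * g₁ s + x) (sym (ℤ.*-identityˡ _)))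
  -- The wedge that is left sits in degree `m`. In degree zero it vanishes, having no constant term;
  -- in a successor degree the induction hypothesis turns it into the `inside` part of `b ⌟ g`.
  step : ∀ m → (b zero * inner m f₀ g₁ + -1ℤ * inner m (b′ ∧ f₁) g₁) +
               inner m f₀ (b′ ⌟ g₀) ≡ inner m f (b ⌟ g)
  step zero = begin
    (b zero * inner zero f₀ g₁ + -1ℤ * inner zero (b′ ∧ f₁) g₁) + inner zero f₀ (b′ ⌟ g₀)
      ≡⟨ cong (λ x → (b zero * inner zero f₀ g₁ + -1ℤ * x) + inner zero f₀ (b′ ⌟ g₀))
           (inner-zero-∧ b′ f₁ g₁) ⟩
    (b zero * inner zero f₀ g₁ + 0ℤ) + inner zero f₀ (b′ ⌟ g₀)
      ≡⟨ rearrange (b zero) _ _ ⟩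
    b zero * inner zero f₀ g₁ + 1ℤ * inner zero f₀ (b′ ⌟ g₀)
      ≡⟨ split zero ⟨
    inner zero f (b ⌟ g) ∎
    where
    rearrange : ∀ b x y → (b * x + 0ℤ) + y ≡ b * x + 1ℤ * y
    rearrange = solve-∀
  step (suc m) = begin
    (b zero * inner (suc m) f₀ g₁ + -1ℤ * inner (suc m) (b′ ∧ f₁) g₁) +
      inner (suc m) f₀ (b′ ⌟ g₀)
      ≡⟨ cong (λ x → (b zero * inner (suc m) f₀ g₁ + -1ℤ * x) + inner (suc m) f₀ (b′ ⌟ g₀))
           (∧-⌟-adjoint m b′ f₁ g₁) ⟩
    (b zero * inner (suc m) f₀ g₁ + -1ℤ * inner m f₁ (b′ ⌟ g₁)) +
      inner (suc m) f₀ (b′ ⌟ g₀)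
      ≡⟨ rearrange (b zero) _ _ _ ⟩
    (-1ℤ * inner m f₁ (b′ ⌟ g₁) + 0ℤ) +
      (b zero * inner (suc m) f₀ g₁ + 1ℤ * inner (suc m) f₀ (b′ ⌟ g₀))
      ≡⟨ cong₂ _+_
           (inner-linearʳ m f₁ -1ℤ (b′ ⌟ g₁) 0ℤ (b′ ⌟ g₁) (λ _ → sym (ℤ.+-identityʳ _)))
           (split (suc m)) ⟨
    inner (suc m) f (b ⌟ g) ∎
    where
    rearrange : ∀ b x y z → (b * x + -1ℤ * y) + z ≡ (-1ℤ * y + 0ℤ) + (b * x + 1ℤ * z)
    rearrange = solve-∀

-- Norms of wedges of orthogonal vectors

𝟏 : Form n
𝟏 []            = 1ℤ
𝟏 (inside  ∷ s) = 0ℤ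
𝟏 (outside ∷ s) = 𝟏 s

⌟-𝟏 : ∀ (a : Fin n → ℤ) s → (a ⌟ 𝟏) s ≡ 0ℤ
⌟-𝟏 a []            = refl
⌟-𝟏 a (inside  ∷ s) = cong (-1ℤ *_) (⌟-zero (a ∘ suc) (λ _ → refl) s)
⌟-𝟏 a (outside ∷ s) = cong₂ _+_ (ℤ.*-zeroʳ (a zero)) (⌟-𝟏 (a ∘ suc) s)

norm-𝟏 : ∀ n → inner {n} zero 𝟏 𝟏 ≡ 1ℤ
norm-𝟏 zero    = refl
norm-𝟏 (suc n) = norm-𝟏 n

⋀ : Matrix m n → Form n
⋀ {zero}  R = 𝟏
⋀ {suc m} R = R zero ∧ ⋀ (R ∘ suc)

-- Anticommutation moves `a` past one factor at a time. Each move leaves a scalar `a · R i`, which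
-- is zero, and at the end `a` meets the unit `𝟏`, which every contraction kills.
⌟-⋀ : ∀ (a : Fin n → ℤ) (R : Matrix m n) → (∀ i → a · R i ≡ 0ℤ) →
      ∀ s → (a ⌟ ⋀ R) s ≡ 0ℤ
⌟-⋀ {m = zero}  a R a⊥R s = ⌟-𝟏 a s
⌟-⋀ {m = suc m} a R a⊥R s = begin
  (a ⌟ R zero ∧ w) s                        ≡⟨ ℤ.+-identityʳ _ ⟨
  (a ⌟ R zero ∧ w) s + 0ℤ
    ≡⟨ cong (λ x → (a ⌟ R zero ∧ w) s + x) (∧-zero (R zero) (⌟-⋀ a (R ∘ suc) (a⊥R ∘ suc)) s) ⟨
  (a ⌟ R zero ∧ w) s + (R zero ∧ a ⌟ w) s   ≡⟨ ⌟-∧-anticommute a (R zero) w s ⟩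
  a · R zero * w s                          ≡⟨ cong (_* w s) (a⊥R zero) ⟩
  0ℤ                                        ∎
  where
  w = ⋀ (R ∘ suc)

-- Adjointness moves the first row `r` to the other side. There `r ⌟ r ∧ w` is `r · r` times `w`
-- minus `r ∧ r ⌟ w`, and the latter vanishes since `r` is orthogonal to the rows of `w`. Each row
-- thus contributes one factor `c`.
norm-⋀ : ∀ (R : Matrix m n) c → (∀ i → R i · R i ≡ c) →
         (∀ {i k} → i ≢ k → R i · R k ≡ 0ℤ) → inner m (⋀ R) (⋀ R) ≡ c ^ m
norm-⋀ {zero}  {n} R c diagonal orthogonal = norm-𝟏 n
norm-⋀ {suc m} R c diagonal orthogonal = begin
  inner (suc m) (r ∧ w) (r ∧ w)   ≡⟨ ∧-⌟-adjoint m r w (r ∧ w) ⟩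
  inner m w (r ⌟ r ∧ w)           ≡⟨ inner-linearʳ m w c w 0ℤ w scale ⟩
  c * inner m w w + 0ℤ            ≡⟨ ℤ.+-identityʳ _ ⟩
  c * inner m w w                 ≡⟨ cong (c *_) (norm-⋀ (R ∘ suc) c (diagonal ∘ suc)
                                       (λ i≢k → orthogonal (i≢k ∘ Fin.suc-injective))) ⟩
  c * c ^ m                       ∎
  where
  r = R zero
  w = ⋀ (R ∘ suc)
  -- The trailing `0ℤ` is what `0ℤ * w s` computes to, as `inner-linearʳ` expects a combination of
  -- two forms.
  scale : ∀ s → (r ⌟ r ∧ w) s ≡ c * w s + 0ℤ
  scale s = begin
    (r ⌟ r ∧ w) s                     ≡⟨ ℤ.+-identityʳ _ ⟨
    (r ⌟ r ∧ w) s + 0ℤ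
      ≡⟨ cong (λ x → (r ⌟ r ∧ w) s + x)
           (∧-zero r (⌟-⋀ r (R ∘ suc) (λ i → orthogonal {zero} {suc i} λ ())) s) ⟨
    (r ⌟ r ∧ w) s + (r ∧ r ⌟ w) s     ≡⟨ ⌟-∧-anticommute r r w s ⟩
    r · r * w s                       ≡⟨ cong (_* w s) (diagonal zero) ⟩
    c * w s                           ≡⟨ ℤ.+-identityʳ _ ⟨
    c * w s + 0ℤ                      ∎

-- Coordinates of wedge products are minors

-- Cofactor expansion along a row `b`, with `f` as the minor of the remaining rows: the first column
-- is either used for `b`, or kept for `f` at the cost of a sign. This recursion on lists mirrors
-- that of `_∧_` on subsets.
expand : (A → ℤ) → (List A → ℤ) → List A → ℤ
expand b f []       = 0ℤ
expand b f (x ∷ xs) = b x * f xs + -1ℤ * expand b (f ∘ (x ∷_)) xs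

-- minor R xs is the determinant of the columns xs of R if length xs ≡ m, and 0 otherwise.
minor : (Fin m → A → ℤ) → List A → ℤ
minor {zero}  R []      = 1ℤ
minor {zero}  R (_ ∷ _) = 0ℤ
minor {suc m} R         = expand (R zero) (minor (R ∘ suc))

-- Selecting column `j` means having kept `j` earlier ones, so the nested signs accumulate to
-- `-1ℤ ^ toℕ j`; the columns that remain are those enumerated by `punchIn j`.
expand-tabulate : ∀ (b : A → ℤ) f (c : Fin (suc m) → A) →
  expand b f (tabulate c) ≡
  sum λ j → -1ℤ ^ toℕ j * b (c j) * f (tabulate (c ∘ punchIn j))
expand-tabulate {m = zero}  b f c = unit (b (c zero)) _
  where
  unit : ∀ x y → x * y + 0ℤ ≡ 1ℤ * x * y + 0ℤ
  unit = solve-∀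
expand-tabulate {m = suc m} b f c = cong₂ _+_
  (cong (_* f (tabulate (c ∘ suc))) (sym (ℤ.*-identityˡ (b (c zero)))))
  (begin
    -1ℤ * expand b (f ∘ (c zero ∷_)) (tabulate (c ∘ suc))
      ≡⟨ cong (-1ℤ *_) (expand-tabulate b (f ∘ (c zero ∷_)) (c ∘ suc)) ⟩
    -1ℤ * sum terms
      ≡⟨ *-distribˡ-sum -1ℤ terms ⟩
    sum (λ j → -1ℤ * terms j)
      ≡⟨ sum-cong-≗ (λ j → assoc (-1ℤ ^ toℕ j) (b (c (suc j)))
           (f (c zero ∷ tabulate (c ∘ suc ∘ punchIn j)))) ⟩
    sum (λ j → -1ℤ ^ toℕ (suc j) * b (c (suc j)) * f (tabulate (c ∘ punchIn (suc j)))) ∎)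
  where
  terms = λ j → -1ℤ ^ toℕ j * b (c (suc j)) * f (c zero ∷ tabulate (c ∘ suc ∘ punchIn j))
  assoc : ∀ x y z → -1ℤ * (x * y * z) ≡ -1ℤ * x * y * z
  assoc = solve-∀

det-minor : ∀ (R : Fin m → A → ℤ) (c : Fin m → A) →
            minor R (tabulate c) ≡ det (λ i j → R i (c j))
det-minor {zero}  R c = refl
det-minor {suc m} R c = trans (expand-tabulate (R zero) (minor (R ∘ suc)) c)
  (sum-cong-≗ λ j → cong (-1ℤ ^ toℕ j * R zero (c j) *_)
    (det-minor (R ∘ suc) (c ∘ punchIn j)))

elements : Subset n → List (Fin n)
elements []            = []
elements (inside  ∷ s) = zero ∷ List.map suc (elements s)
elements (outside ∷ s) = List.map suc (elements s)

expand-map : ∀ (b : B → ℤ) f (h : A → B) xs →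
             expand b f (List.map h xs) ≡ expand (b ∘ h) (f ∘ List.map h) xs
expand-map b f h []       = refl
expand-map b f h (x ∷ xs) = cong (λ y → b (h x) * f (List.map h xs) + -1ℤ * y)
  (expand-map b (f ∘ (h x ∷_)) h xs)

-- The two recursions agree clause by clause: an `inside` entry is a cons cell, and an `outside`
-- entry only shifts indices, which `expand-map` absorbs.
∧-elements : ∀ (b : Fin n → ℤ) f s → (b ∧ (f ∘ elements)) s ≡ expand b f (elements s)
∧-elements b f []            = refl
∧-elements b f (inside  ∷ s) =
  cong (λ y → b zero * f (List.map suc (elements s)) + -1ℤ * y)
    (trans (∧-elements (b ∘ suc) (f ∘ (zero ∷_) ∘ List.map suc) s)
      (sym (expand-map b (f ∘ (zero ∷_)) suc (elements s))))
∧-elements b f (outside ∷ s) =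
  trans (∧-elements (b ∘ suc) (f ∘ List.map suc) s)
    (sym (expand-map b f suc (elements s)))

⋀-minor : ∀ (R : Matrix m n) → ⋀ R ≗ minor R ∘ elements
⋀-minor {suc m} R s = trans (∧-cong (R zero) (⋀-minor (R ∘ suc)) s)
  (∧-elements (R zero) (minor (R ∘ suc)) s)
⋀-minor {zero}  R []            = refl
⋀-minor {zero}  R (inside  ∷ s) = refl
⋀-minor {zero} {suc n} R (outside ∷ s) =
  trans (⋀-minor (λ i → R i ∘ suc) s) (minor-map-suc (elements s))
  where
  -- With no rows, `minor` only tests whether the list is empty, and mapping preserves this.
  minor-map-suc : ∀ xs → minor (λ i → R i ∘ suc) xs ≡ minor R (List.map suc xs)
  minor-map-suc []      = refl
  minor-map-suc (_ ∷ _) = refl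

-- Sums over choices

∑ : (A → ℤ) → List A → ℤ
∑ f xs = foldr _+_ 0ℤ (List.map f xs)

∑-++ : ∀ (f : A → ℤ) xs ys → ∑ f (xs ++ ys) ≡ ∑ f xs + ∑ f ys
∑-++ f []       ys = sym (ℤ.+-identityˡ _)
∑-++ f (x ∷ xs) ys = trans (cong (λ y → f x + y) (∑-++ f xs ys)) (sym (ℤ.+-assoc (f x) _ _))

∑-map : ∀ (f : B → ℤ) (h : A → B) xs → ∑ f (List.map h xs) ≡ ∑ (f ∘ h) xs
∑-map f h xs = cong (foldr _+_ 0ℤ) (sym (List.map-∘ xs))

∑-cong : ∀ {f g : A → ℤ} → f ≗ g → ∑ f ≗ ∑ g
∑-cong eq xs = cong (foldr _+_ 0ℤ) (List.map-cong eq xs)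

-- For a Hadamard matrix the sum over columns is the same for every choice of rows. The hypothesis
-- ranges over the members of `xs` because this constancy is derived for increasing choices of rows.
∑-cartesianProduct : ∀ (f : A × B → ℤ) {k xs ys} →
  ListAll.All (λ x → ∑ (λ y → f (x , y)) ys ≡ k) xs →
  ∑ f (cartesianProduct xs ys) ≡ + length xs * k
∑-cartesianProduct f []                               = refl
∑-cartesianProduct f {k} {x ∷ xs} {ys} (eq ∷ eqs) = begin
  ∑ f (List.map (x ,_) ys ++ cartesianProduct xs ys)
    ≡⟨ ∑-++ f (List.map (x ,_) ys) _ ⟩
  ∑ f (List.map (x ,_) ys) + ∑ f (cartesianProduct xs ys)
    ≡⟨ cong₂ _+_ (trans (∑-map f (x ,_) ys) eq) (∑-cartesianProduct f eqs) ⟩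
  k + + length xs * k
    ≡⟨ ℤ.suc-* (+ length xs) k ⟨
  + length (x ∷ xs) * k ∎

-- `choices` and `inner` branch alike on whether the first index is selected. Functions of lists
-- make the two comparable, since vectors and subsets both yield their list of elements.
inner-choices : ∀ n m (f g : List (Fin n) → ℤ) →
  ∑ (λ c → f (toList c) * g (toList c)) (choices n m) ≡
  inner m (f ∘ elements) (g ∘ elements)
inner-choices zero    zero    f g = ℤ.+-identityʳ _
inner-choices (suc n) zero    f g = inner-choices n zero (f ∘ List.map suc) (g ∘ List.map suc)
inner-choices zero    (suc m) f g = refl
inner-choices (suc n) (suc m) f g = begin
  ∑ F (List.map zero∷ (choices n m) ++ List.map (Vec.map suc) (choices n (suc m)))
    ≡⟨ ∑-++ F (List.map zero∷ (choices n m)) _ ⟩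
  ∑ F (List.map zero∷ (choices n m)) + ∑ F (List.map (Vec.map suc) (choices n (suc m)))
    ≡⟨ cong₂ _+_
         (trans (∑-map F zero∷ (choices n m))
           (trans (∑-cong (λ c → cong (λ xs → f (zero ∷ xs) * g (zero ∷ xs))
                                   (Vec.toList-map suc c)) (choices n m))
             (inner-choices n m (f ∘ (zero ∷_) ∘ List.map suc)
                                (g ∘ (zero ∷_) ∘ List.map suc))))
         (trans (∑-map F (Vec.map suc) (choices n (suc m)))
           (trans (∑-cong (λ c → cong (λ xs → f xs * g xs)
                                   (Vec.toList-map suc c)) (choices n (suc m)))
             (inner-choices n (suc m) (f ∘ List.map suc) (g ∘ List.map suc)))) ⟩
  inner (suc m) (f ∘ elements) (g ∘ elements) ∎
  where
  F : ∀ {k} → Vec (Fin (suc n)) k → ℤ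
  F c = f (toList c) * g (toList c)
  zero∷ : Vec (Fin n) m → Vec (Fin (suc n)) (suc m)
  zero∷ s = zero ∷ Vec.map suc s

toList≡tabulate : ∀ (c : Vec A m) → toList c ≡ tabulate (lookup c)
toList≡tabulate []      = refl
toList≡tabulate (x ∷ c) = cong (x ∷_) (toList≡tabulate c)

inner-cong : ∀ m {f g : Form n} → f ≗ g → inner m f f ≡ inner m g g
inner-cong {zero}  zero    eq = cong₂ _*_ (eq []) (eq [])
inner-cong {zero}  (suc m) eq = refl
inner-cong {suc n} zero    eq = inner-cong zero (eq ∘ (outside ∷_))
inner-cong {suc n} (suc m) eq =
  cong₂ _+_ (inner-cong m (eq ∘ (inside ∷_))) (inner-cong (suc m) (eq ∘ (outside ∷_)))

-- The Cauchy-Binet formula for `R ⊗ R ᵀ`, with the squared norm of the wedge in place of the Gram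
-- determinant.
∑-det² : ∀ (R : Matrix m n) →
  ∑ (λ c → det (λ i j → R i (lookup c j)) ^ 2) (choices n m) ≡ inner m (⋀ R) (⋀ R)
∑-det² {m} {n} R = begin
  ∑ (λ c → det (λ i j → R i (lookup c j)) ^ 2) (choices n m)
    ≡⟨ ∑-cong (λ c → square (minor≡det c)) (choices n m) ⟨
  ∑ (λ c → minor R (toList c) * minor R (toList c)) (choices n m)
    ≡⟨ inner-choices n m (minor R) (minor R) ⟩
  inner m (minor R ∘ elements) (minor R ∘ elements)
    ≡⟨ inner-cong m (⋀-minor R) ⟨
  inner m (⋀ R) (⋀ R) ∎
  where
  minor≡det : ∀ c → minor R (toList c) ≡ det (λ i j → R i (lookup c j))
  minor≡det c = trans (cong (minor R) (toList≡tabulate c)) (det-minor R (lookup c))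
  square : ∀ {x y} → x ≡ y → x * x ≡ y ^ 2
  square {x} refl = cong (x *_) (sym (ℤ.*-identityʳ x))

-- Squared minors of a Hadamard matrix

module _ {n} {H : Matrix n n} (hadamard : IsHadamard H) where
  open IsHadamard hadamard

  rows-diagonal : ∀ i → H i · H i ≡ + n
  -- `H i · H k` is by definition the entry of `H ⊗ H ᵀ` at `i` and `k`.
  rows-diagonal i = trans (orthogonal i i) (trans (cong (+ n *_) 𝟙-diagonal) (ℤ.*-identityʳ (+ n)))
    where
    𝟙-diagonal : 𝟙 i i ≡ 1ℤ
    𝟙-diagonal with i Fin.≟ i
    ... | yes _  = refl
    ... | no i≢i = ⊥-elim (i≢i refl)

  rows-orthogonal : ∀ {i k} → i ≢ k → H i · H k ≡ 0ℤ
  rows-orthogonal {i} {k} i≢k =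
    trans (orthogonal i k) (trans (cong (+ n *_) 𝟙-off) (ℤ.*-zeroʳ (+ n)))
    where
    𝟙-off : 𝟙 i k ≡ 0ℤ
    𝟙-off with i Fin.≟ k
    ... | yes i≡k = ⊥-elim (i≢k i≡k)
    ... | no  _   = refl

  ∑-minors² : ∀ m (r : Vec (Fin n) m) → Increasing r →
              ∑ (λ c → det (submatrix H r c) ^ 2) (choices n m) ≡ (+ n) ^ m
  ∑-minors² m r inc = trans (∑-det² (H ∘ lookup r))
    (norm-⋀ (H ∘ lookup r) (+ n) (rows-diagonal ∘ lookup r)
      -- An increasing vector has distinct entries, so distinct positions pick distinct rows of `H`.
      λ {i} {k} i≢k → rows-orthogonal
        (i≢k ∘ lookup-injective (AllPairs.map Fin.<⇒≢ inc) i k))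

  ∑-submatrices : ∀ m → ∑ (λ M → det M ^ 2) (submatrices m H) ≡ + (n C m) * (+ n) ^ m
  ∑-submatrices m = begin
    ∑ (λ M → det M ^ 2) (submatrices m H)
      ≡⟨ ∑-map (λ M → det M ^ 2) (uncurry (submatrix H))
           (cartesianProduct (choices n m) (choices n m)) ⟩
    ∑ (λ p → det (uncurry (submatrix H) p) ^ 2) (cartesianProduct (choices n m) (choices n m))
      ≡⟨ ∑-cartesianProduct (λ p → det (uncurry (submatrix H) p) ^ 2)
           (ListAll.map (∑-minors² m _) (choices-increasing n m)) ⟩
    + length (choices n m) * (+ n) ^ m
      ≡⟨ cong (λ l → + l * (+ n) ^ m) (length-choices n m) ⟩
    + (n C m) * (+ n) ^ m ∎

-- The strict inequality

-- The absorption identity. Pascal's rule splits the left side, the identity for `n` applies at `k`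
-- and at `suc k`, and Pascal's rule joins the results.
[k+1]*[n+1]C[k+1]≡[n+1]*nCk : ∀ n k → suc k ℕ.* (suc n C suc k) ≡ suc n ℕ.* (n C k)
[k+1]*[n+1]C[k+1]≡[n+1]*nCk zero    zero    = refl
[k+1]*[n+1]C[k+1]≡[n+1]*nCk zero    (suc k) = ℕ.*-zeroʳ (suc (suc k))
[k+1]*[n+1]C[k+1]≡[n+1]*nCk (suc n) zero    = begin
  1 ℕ.* (suc (suc n) C 1)  ≡⟨ ℕ.*-identityˡ _ ⟩
  suc (suc n) C 1          ≡⟨ nC1≡n (suc (suc n)) ⟩
  suc (suc n)              ≡⟨ ℕ.*-identityʳ _ ⟨
  suc (suc n) ℕ.* 1        ∎
[k+1]*[n+1]C[k+1]≡[n+1]*nCk (suc n) (suc k) = begin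
  suc (suc k) ℕ.* (suc (suc n) C suc (suc k))
    ≡⟨ cong (suc (suc k) ℕ.*_) (nCk+nC[k+1]≡[n+1]C[k+1] (suc n) (suc k)) ⟨
  suc (suc k) ℕ.* (x ℕ.+ (suc n C suc (suc k)))
    ≡⟨ distrib (suc k) x _ ⟩
  x ℕ.+ (suc k ℕ.* x ℕ.+ suc (suc k) ℕ.* (suc n C suc (suc k)))
    ≡⟨ cong₂ (λ y z → x ℕ.+ (y ℕ.+ z)) ([k+1]*[n+1]C[k+1]≡[n+1]*nCk n k)
                                       ([k+1]*[n+1]C[k+1]≡[n+1]*nCk n (suc k)) ⟩
  x ℕ.+ (suc n ℕ.* (n C k) ℕ.+ suc n ℕ.* (n C suc k))
    ≡⟨ cong (x ℕ.+_) (ℕ.*-distribˡ-+ (suc n) (n C k) (n C suc k)) ⟨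
  x ℕ.+ suc n ℕ.* ((n C k) ℕ.+ (n C suc k))
    ≡⟨ cong (λ y → x ℕ.+ suc n ℕ.* y) (nCk+nC[k+1]≡[n+1]C[k+1] n k) ⟩
  suc (suc n) ℕ.* x ∎
  where
  x = suc n C suc k
  distrib : ∀ a x y → suc a ℕ.* (x ℕ.+ y) ≡ x ℕ.+ (a ℕ.* x ℕ.+ suc a ℕ.* y)
  distrib = ℕSolver.solve-∀

-- `m ! ℕ.* (n C m)` is the falling factorial of `n` with `m` factors; this splits off the leading
-- factor.
[m+1]!*[n+1]C[m+1] : ∀ n m → suc m ! ℕ.* (suc n C suc m) ≡ suc n ℕ.* (m ! ℕ.* (n C m))
[m+1]!*[n+1]C[m+1] n m = begin
  suc m ℕ.* m ! ℕ.* (suc n C suc m)      ≡⟨ swap (suc m) (m !) _ ⟩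
  m ! ℕ.* (suc m ℕ.* (suc n C suc m))    ≡⟨ cong (m ! ℕ.*_) ([k+1]*[n+1]C[k+1]≡[n+1]*nCk n m) ⟩
  m ! ℕ.* (suc n ℕ.* (n C m))            ≡⟨ swap′ (m !) (suc n) _ ⟩
  suc n ℕ.* (m ! ℕ.* (n C m))            ∎
  where
  swap : ∀ a b c → a ℕ.* b ℕ.* c ≡ b ℕ.* (a ℕ.* c)
  swap = ℕSolver.solve-∀
  swap′ : ∀ a b c → a ℕ.* (b ℕ.* c) ≡ b ℕ.* (a ℕ.* c)
  swap′ = ℕSolver.solve-∀

m!*nCm≤n^m : ∀ n m → m ! ℕ.* (n C m) ≤ n ℕ.^ m
m!*nCm≤n^m n       zero    = ℕ.≤-refl
m!*nCm≤n^m zero    (suc m) = ℕ.≤-reflexive (ℕ.*-zeroʳ (suc m !))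
m!*nCm≤n^m (suc n) (suc m) = ℕ.≤-trans
  (ℕ.≤-reflexive ([m+1]!*[n+1]C[m+1] n m))
  (ℕ.*-monoʳ-≤ (suc n) (ℕ.≤-trans (m!*nCm≤n^m n m) (ℕ.^-monoˡ-≤ m (ℕ.n≤1+n n))))

-- Once the leading factor is split off, `1 < m` leaves at least one more, and there the bound by
-- powers of the predecessor of `n` is strictly improved. `m ≤ n` excludes `n = 0`, where both sides
-- would vanish.
m!*nCm<n^m : 1 < m → m ≤ n → m ! ℕ.* (n C m) < n ℕ.^ m
m!*nCm<n^m {suc (suc m)} {suc n} (s≤s (s≤s z≤n)) _ = ℕ.≤-<-trans
  (ℕ.≤-reflexive ([m+1]!*[n+1]C[m+1] n (suc m)))
  (ℕ.*-monoʳ-< (suc n)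
    (ℕ.≤-<-trans (m!*nCm≤n^m n (suc m)) (ℕ.^-monoˡ-< (suc m) (ℕ.n<1+n n))))

-- Fractions in `ℚ` are normalised, so the comparison passes to unnormalised representatives, whose
-- order is cross-multiplication. `mkℚᵘ` takes the denominator minus one, hence the argument `0` for
-- denominator 1.
/1< : ∀ a p d .{{_ : NonZero d}} → a ℕ.* d < p → + p / d > + a / 1
/1< a p (suc d) a*d<p = ℚ.toℚᵘ-cancel-<
  (ℚᵘ.<-respˡ-≃ (ℚᵘ.≃-sym (ℚ.toℚᵘ-fromℚᵘ (mkℚᵘ (+ a) 0)))
    (ℚᵘ.<-respʳ-≃ (ℚᵘ.≃-sym (ℚ.toℚᵘ-fromℚᵘ (mkℚᵘ (+ p) d)))
      (*<* (subst (+ a * + suc d ℤ.<_) (sym (ℤ.*-identityʳ (+ p)))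
        (subst (ℤ._< + p) (ℤ.pos-* a (suc d)) (+<+ a*d<p))))))

corollary1 : ∀ {n m : ℕ} (H : Matrix n n) → IsHadamard H →
    1 < m → (m≤n : m ≤ n) →
    mean (λ M → det M ^ 2) (submatrices m H) {{submatrices-nonZero H m≤n}} > + (m !) / 1
corollary1 {n} {m} H hadamard 1<m m≤n =
  subst (λ t → (t / d) > + (m !) / 1) (sym total)
    (/1< (m !) ((n C m) ℕ.* n ℕ.^ m) d bound)
  where
  d = length (submatrices m H)
  instance
    d≢0 : NonZero d
    d≢0 = submatrices-nonZero H m≤n
    -- The number `d` of submatrices is `(n C m) ℕ.^ 2` and is nonzero. `bound` multiplies a strict
    -- inequality by `n C m`, which must therefore be nonzero.
    nCm≢0 : NonZero (n C m)
    nCm≢0 = ℕ.≢-nonZero λ nCm≡0 → ℕ.≢-nonZero⁻¹ d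
      (trans (length-submatrices m H) (cong (ℕ._^ 2) nCm≡0))
  pos-^ : ∀ k → (+ n) ^ k ≡ + (n ℕ.^ k)
  pos-^ zero    = refl
  pos-^ (suc k) = trans (cong (+ n *_) (pos-^ k)) (sym (ℤ.pos-* n (n ℕ.^ k)))
  total : ∑ (λ M → det M ^ 2) (submatrices m H) ≡ + ((n C m) ℕ.* n ℕ.^ m)
  total = trans (∑-submatrices hadamard m)
    (trans (cong (+ (n C m) *_) (pos-^ m)) (sym (ℤ.pos-* (n C m) (n ℕ.^ m))))
  rearrange : ∀ a l → a ℕ.* (l ℕ.* (l ℕ.* 1)) ≡ l ℕ.* (a ℕ.* l)
  rearrange = ℕSolver.solve-∀
  -- As `d` is the square of `n C m`, one factor `n C m` is common to both sides, and `m!*nCm<n^m`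
  -- compares what is left.
  bound : m ! ℕ.* d < (n C m) ℕ.* n ℕ.^ m
  bound = ℕ.≤-<-trans
    (ℕ.≤-reflexive (trans (cong (m ! ℕ.*_) (length-submatrices m H)) (rearrange (m !) (n C m))))
    (ℕ.*-monoʳ-< (n C m) (m!*nCm<n^m 1<m m≤n))
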